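{- Let $p$ be an odd prime number and let $S=(s_1,\dots,s_n)$ be a finite sequence of elements of $(\mathbb{Z}/p\mathbb{Z})^*=\mathbb{Z}/p\mathbb{Z}\setminus\{0\}$ (repetitions allowed). Let $l_1\geqslant l_2\geqslant\dots\geqslant l_d$ be the list of all common multiplicities of $S$ (one for each pair $\{x,-x\}$ with $x$ or $-x$ occurring in $S$), ordered decreasingly. Then \[|\Sigma(S)|\geqslant\min\left\{p,\,1+\sum_{i=1}^d i\,l_i\right\}\quad\text{and}\quad|\Sigma^*(S)|\geqslant\min\left\{p,\,\sum_{i=1}^d i\,l_i\right\}.\]
   Context: For a sequence $S=(s_1,\dots,s_n)$ in $\mathbb{Z}/p\mathbb{Z}$, $\Sigma(S)=\{\sum_{i\in I}s_i : I\subset[1,n]\}$ (including the empty sum $0$) and $\Sigma^*(S)=\{\sum_{i\in I}s_i:\emptyset\neq I\subset[1,n]\}$. For $x\neq 0$, the common multiplicity of the pair $(x,-x)$ in $S$ is the sum of the multiplicity of $x$ in $S$ and the multiplicity of $-x$ in $S$. -}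

module Defs where

open import Data.Nat using (ℕ; zero; suc; _+_; _*_; _∸_; _≤?_; _<?_; NonZero)
open import Data.Nat.Properties using (≤-decTotalOrder)
open import Data.Nat.DivMod using (_mod_; _/_)
open import Data.Fin using (Fin; toℕ; _≟_)
open import Data.List using (List; []; _∷_; map; filter; length; reverse; _++_; allFin)
open import Data.List.Sort.MergeSort ≤-decTotalOrder using (sort)
open import Relation.Nullary.Decidable using (_×-dec_)

module _ (p : ℕ) .{{_ : NonZero p}} where

  zeroₚ : Fin p
  zeroₚ = 0 mod p

  _+ₚ_ : Fin p → Fin p → Fin p
  x +ₚ y = (toℕ x + toℕ y) mod p

  -ₚ_ : Fin p → Fin p
  -ₚ x = (p ∸ toℕ x) mod p

  subsetSums : List (Fin p) → List (Fin p)
  subsetSums [] = zeroₚ ∷ []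
  subsetSums (s ∷ S) = subsetSums S ++ map (s +ₚ_) (subsetSums S)

  subsetSums* : List (Fin p) → List (Fin p)
  subsetSums* [] = []
  subsetSums* (s ∷ S) = subsetSums* S ++ (s ∷ map (s +ₚ_) (subsetSums* S))

  card : List (Fin p) → ℕ
  card L = length (filter (λ x → x ∈? L) (allFin p))
    where open import Data.List.Membership.DecPropositional (_≟_ {p}) using (_∈?_)

  |Σ| : List (Fin p) → ℕ
  |Σ| S = card (subsetSums S)

  |Σ*| : List (Fin p) → ℕ
  |Σ*| S = card (subsetSums* S)

  mult : Fin p → List (Fin p) → ℕ
  mult x S = length (filter (_≟ x) S)

  commonMult : List (Fin p) → Fin p → ℕ
  commonMult S x = mult x S + mult (-ₚ x) S

  -- one representative of each pair {x, -x} with x ≠ 0 (p odd):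
  -- the residues x with 1 ≤ x ≤ (p-1)/2 = ⌊p/2⌋
  reps : List (Fin p)
  reps = filter (λ x → (1 ≤? toℕ x) ×-dec (toℕ x ≤? p / 2)) (allFin p)

  commonMults : List (Fin p) → List ℕ
  commonMults S = reverse (sort (filter (0 <?_) (map (commonMult S) reps)))

weightedSumFrom : ℕ → List ℕ → ℕ
weightedSumFrom k [] = 0
weightedSumFrom k (l ∷ ls) = k * l + weightedSumFrom (suc k) ls

weightedSum : List ℕ → ℕ
weightedSum = weightedSumFrom 1

{-# OPTIONS --safe #-}
module Submission where

-- Write the elements of S as entries x(i , j), where (i , j) is the j-th copy of
-- the i-th largest class {x , -x}; the entries of a row j are non-zero and
-- distinct up to sign.  The set of subset sums is stable under the reflections
-- of type B acting on rows (change a sign and shift the base point, or swap two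
-- neighbours).  The corresponding divided differences lower the degree by one,
-- so a word w of m of them maps Π (base - root k), with m roots, to a constant
-- that does not depend on x.  If the roots cover the subset sums modulo p, this
-- constant is 0 modulo p.  On the other hand, evaluating at x(i , j) = i + 1 and
-- root k = k, where a subset sum is the height of the subset, the constant is
-- seen to divide m!, provided the word climbs to a subset of height m; such
-- words exist for all m up to the total height Σ i lᵢ.  Hence m ≥ p or
-- m > Σ i lᵢ.  Sums are taken over complements: for m < Σ i lᵢ the full subset,
-- i.e. the empty sum, is then never reached, which gives the bound for Σ*.

open import Defs
open import Data.Bool using (Bool; true; false; not)
open import Data.Empty using (⊥-elim)
open import Data.Fin using (Fin; toℕ; _≟_)
open import Data.Fin.Properties using (toℕ-fromℕ<; toℕ<n; toℕ-injective)
open import Data.Integer using (ℤ; +_; -_; _+_; _-_; _*_; 0ℤ; 1ℤ; -1ℤ)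
import Data.Integer as ℤ using (∣_∣)
open import Data.Integer.Divisibility.Signed using (_∣_; divides; 0∣⇒≡0; ∣m∣n⇒∣m-n; ∣m∣n⇒∣m+n; ∣m⇒∣m*n; ∣n⇒∣m*n; ∣m⇒∣-m; ∣ᵤ⇒∣; ∣⇒∣ᵤ; ∣-refl; ∣-trans)
open import Data.Integer.Properties using (*-distribˡ-+; +-assoc; +-identityʳ; +-injective; pos-+; pos-*; m-n≡m⊖n; ⊖-≥; abs-*; i*j≡0⇒i≡0∨j≡0; i-j≡0⇒i≡j; i≡j⇒i-j≡0)
open import Data.Integer.Tactic.RingSolver using (solve-∀)
open import Data.List using (List; []; _∷_; length; map; filter; allFin; reverse)
open import Data.List.Membership.Propositional using (_∈_; lose)
open import Data.List.Membership.Propositional.Properties using (∈-++⁺ˡ; ∈-++⁺ʳ; ∈-map⁺; ∈-filter⁺; ∈-filter⁻; ∈-allFin)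
open import Data.List.Properties using (filter-accept; filter-reject; filter-some; map-cong-local; length-map; unfold-reverse)
open import Data.List.Relation.Binary.Permutation.Propositional using (_↭_; ↭-sym; ↭-trans; ↭⇒↭ₛ)
open import Data.List.Relation.Binary.Permutation.Propositional.Properties using (All-resp-↭; ∈-resp-↭; ↭-reverse; ↭-map-inv)
import Data.List.Relation.Binary.Permutation.Setoid.Properties as Permₛ
open import Data.List.Relation.Unary.All as All using (All; []; _∷_)
open import Data.List.Relation.Unary.AllPairs using (AllPairs; []; _∷_)
import Data.List.Relation.Unary.AllPairs.Properties as AllPairs
open import Data.List.Relation.Unary.Any using (Any; here; there)
open import Data.List.Relation.Unary.Sorted.TotalOrder.Properties using (Sorted⇒AllPairs)
open import Data.List.Relation.Unary.Unique.Propositional using (Unique)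
import Data.List.Relation.Unary.Unique.Propositional.Properties as Unique
open import Data.Nat as ℕ using (ℕ; zero; suc; _≤_; _<_; _≥_; _⊓_; _∸_; _≤?_; _<?_; z≤n; s≤s; NonZero)
open import Data.Nat.DivMod using (_/_; _%_; _mod_; m≡m%n+[m/n]*n; m%n<n; n%n≡0; m<n⇒m%n≡m)
import Data.Nat.Divisibility as ℕ using (_∣_; ∣⇒≤; ∣1⇒≡1)
import Data.Nat.Divisibility as ℕ∣ using (divides)
open import Data.Nat.Primality using (Prime; euclidsLemma; ¬prime[1]; prime⇒irreducible)
import Data.Nat.Properties as ℕ
open import Data.List.Sort.MergeSort.Properties ℕ.≤-decTotalOrder using (sort-↭; sort-↗)
open import Data.Product using (_×_; _,_; ∃; proj₁; proj₂)
open import Data.Product.Properties using (≡-dec)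
open import Data.Sum using (_⊎_; inj₁; inj₂)
open import Function using (_∘_)
open import Relation.Binary.Definitions using (tri<; tri≈; tri>)
open import Relation.Binary.PropositionalEquality
open import Relation.Nullary using (¬_; Dec; yes; no; does)
open import Relation.Nullary.Decidable using (_⊎-dec_)

-- Sites, states and the reflections of type B.

-- The site (i , j) is the j-th copy of the i-th largest class {x , -x}.
Site : Set
Site = ℕ × ℕ

_≟ₛ_ : (s t : Site) → Dec (s ≡ t)
_≟ₛ_ = ≡-dec ℕ._≟_ ℕ._≟_

-- The zeros `root k` are variables too, fixed by every reflection. The constant obtained in degree
-- 0 is then independent of them as well, which permits comparing two states with different zeros.
data Var : Set where
  base : Var
  elt  : Site → Var
  root : ℕ → Var

State : Set
State = Var → ℤ

-- The simple roots of the reflections, not to be confused with the polynomial zeros `root k`: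
-- `act s` changes each coordinate by an integer multiple of `α s`.
α : Site → State → ℤ
α (zero  , j) x = - x (elt (0 , j))
α (suc i , j) x = x (elt (suc i , j)) - x (elt (i , j))

swap : ℕ → ℕ → Site → Site
swap i j t with t ≟ₛ (suc i , j) | t ≟ₛ (i , j)
... | yes _ | _     = i , j
... | no _  | yes _ = suc i , j
... | no _  | no _  = t

flip : Site → Site → ℤ → ℤ
flip s t a with t ≟ₛ s
... | yes _ = - a
... | no _  = a

-- The type B simple reflections: sites (0 , j) shift the base point and change
-- a sign, the other sites transpose two neighbouring entries of the row j.
act : Site → State → State
act (zero  , j) x base     = x base + x (elt (0 , j))
act (zero  , j) x (elt t)  = flip (0 , j) t (x (elt t))
act (suc i , j) x base     = x base
act (suc i , j) x (elt t)  = x (elt (swap i j t))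
act s           x (root k) = x (root k)

-- The coefficient of the root α s in the reflection of the coordinate v.
κ : Site → Var → ℤ
κ (zero  , j) base    = 1ℤ
κ (zero  , j) (elt t) with t ≟ₛ (0 , j)
... | yes _ = - (+ 2)
... | no _  = 0ℤ
κ (suc i , j) base    = 0ℤ
κ (suc i , j) (elt t) with t ≟ₛ (suc i , j) | t ≟ₛ (i , j)
... | yes _ | _     = 1ℤ
... | no _  | yes _ = -1ℤ
... | no _  | no _  = 0ℤ
κ s (root k) = 0ℤ

minus-zero-multiple : ∀ a b → a ≡ a - 0ℤ * b
minus-zero-multiple = solve-∀

act-reflects : ∀ s x v → act s x v ≡ x v - κ s v * α s x
act-reflects (zero  , j) x base = lem (x base) (x (elt (0 , j)))
  where
  lem : ∀ a b → a + b ≡ a - 1ℤ * - b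
  lem = solve-∀
act-reflects (zero  , j) x (elt t) with t ≟ₛ (0 , j)
... | yes refl = lem (x (elt t))
  where
  lem : ∀ a → - a ≡ a - - (+ 2) * - a
  lem = solve-∀
... | no _ = minus-zero-multiple (x (elt t)) (- x (elt (0 , j)))
act-reflects (suc i , j) x base = minus-zero-multiple (x base) (α (suc i , j) x)
act-reflects (suc i , j) x (elt t) with t ≟ₛ (suc i , j) | t ≟ₛ (i , j)
... | yes refl | _ = lem (x (elt t)) (x (elt (i , j)))
  where
  lem : ∀ a b → b ≡ a - 1ℤ * (a - b)
  lem = solve-∀
... | no _ | yes refl = lem (x (elt t)) (x (elt (suc i , j)))
  where
  lem : ∀ a b → b ≡ a - -1ℤ * (b - a)
  lem = solve-∀
... | no _ | no _ = minus-zero-multiple (x (elt t)) (α (suc i , j) x)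
act-reflects (zero , j)  x (root k) = minus-zero-multiple (x (root k)) (α (zero , j) x)
act-reflects (suc i , j) x (root k) = minus-zero-multiple (x (root k)) (α (suc i , j) x)

-- Polynomials and divided differences.

-- Pol n consists of polynomial expressions of degree at most n.
data Pol : ℕ → Set where
  con : ∀ {n} → ℤ → Pol n
  add : ∀ {n} → Pol n → Pol n → Pol n
  scl : ∀ {n} → ℤ → Pol n → Pol n
  mul : ∀ {n} → Var → Pol n → Pol (suc n)

ev : ∀ {n} → Pol n → State → ℤ
ev (con c)   x = c
ev (add q r) x = ev q x + ev r x
ev (scl c q) x = c * ev q x
ev (mul v q) x = x v * ev q x

-- `mul` lands in a successor degree, so no variable occurs in degree 0. This is what carries a
-- constant from the residues modulo p to the principal state.
ev-constant : (q : Pol 0) (x y : State) → ev q x ≡ ev q y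
ev-constant (con c)   x y = refl
ev-constant (add q r) x y = cong₂ _+_ (ev-constant q x y) (ev-constant r x y)
ev-constant (scl c q) x y = cong (c *_) (ev-constant q x y)

mulα : ∀ {n} → Site → Pol n → Pol (suc n)
mulα (zero  , j) q = scl -1ℤ (mul (elt (0 , j)) q)
mulα (suc i , j) q = add (mul (elt (suc i , j)) q) (scl -1ℤ (mul (elt (i , j)) q))

ev-mulα : ∀ {n} s (q : Pol n) x → ev (mulα s q) x ≡ α s x * ev q x
ev-mulα (zero  , j) q x = lem (x (elt (0 , j))) (ev q x)
  where
  lem : ∀ a b → -1ℤ * (a * b) ≡ - a * b
  lem = solve-∀
ev-mulα (suc i , j) q x = lem (x (elt (suc i , j))) (x (elt (i , j))) (ev q x)
  where
  lem : ∀ a b c → a * c + -1ℤ * (b * c) ≡ (a - b) * c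
  lem = solve-∀

-- The substitution is linear in the variables, hence keeps the degree bound.
pull : ∀ {n} → Site → Pol n → Pol n
pull s (con c)   = con c
pull s (add q r) = add (pull s q) (pull s r)
pull s (scl c q) = scl c (pull s q)
pull s (mul v q) = add (mul v (pull s q)) (scl (- κ s v) (mulα s (pull s q)))

ev-pull : ∀ {n} s (q : Pol n) x → ev (pull s q) x ≡ ev q (act s x)
ev-pull s (con c)   x = refl
ev-pull s (add q r) x = cong₂ _+_ (ev-pull s q x) (ev-pull s r x)
ev-pull s (scl c q) x = cong (c *_) (ev-pull s q x)
ev-pull s (mul v q) x = begin
  x v * ev (pull s q) x + - κ s v * ev (mulα s (pull s q)) x
    ≡⟨ cong (λ e → x v * ev (pull s q) x + - κ s v * e) (ev-mulα s (pull s q) x) ⟩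
  x v * ev (pull s q) x + - κ s v * (α s x * ev (pull s q) x)
    ≡⟨ lem (x v) (κ s v) (α s x) (ev (pull s q) x) ⟩
  (x v - κ s v * α s x) * ev (pull s q) x
    ≡⟨ cong₂ _*_ (sym (act-reflects s x v)) (ev-pull s q x) ⟩
  act s x v * ev q (act s x) ∎
  where
  open ≡-Reasoning
  lem : ∀ a k b e → a * e + - k * (b * e) ≡ (a - k * b) * e
  lem = solve-∀

-- Division by `α s` is avoided by taking the twisted Leibniz rule as definition: the difference of
-- v q is v times that of q, plus `κ s v` times the reflected q. For q of degree 0 the first term
-- vanishes and the reflection fixes q.
dd : ∀ {n} → Site → Pol (suc n) → Pol n
dd s (con c)           = con 0ℤ
dd s (add q r)         = add (dd s q) (dd s r)
dd s (scl c q)         = scl c (dd s q)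
dd {zero}  s (mul v q) = scl (κ s v) q
dd {suc n} s (mul v q) = add (mul v (dd s q)) (scl (κ s v) (pull s q))

ev-dd : ∀ {n} s (q : Pol (suc n)) x → α s x * ev (dd s q) x ≡ ev q x - ev q (act s x)
ev-dd s (con c) x = lem (α s x) c
  where
  lem : ∀ a c → a * 0ℤ ≡ c - c
  lem = solve-∀
ev-dd s (add q r) x = begin
  α s x * (ev (dd s q) x + ev (dd s r) x)
    ≡⟨ *-distribˡ-+ (α s x) (ev (dd s q) x) (ev (dd s r) x) ⟩
  α s x * ev (dd s q) x + α s x * ev (dd s r) x
    ≡⟨ cong₂ _+_ (ev-dd s q x) (ev-dd s r x) ⟩
  (ev q x - ev q (act s x)) + (ev r x - ev r (act s x))
    ≡⟨ lem (ev q x) (ev q (act s x)) (ev r x) (ev r (act s x)) ⟩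
  ev q x + ev r x - (ev q (act s x) + ev r (act s x)) ∎
  where
  open ≡-Reasoning
  lem : ∀ a b c d → (a - b) + (c - d) ≡ a + c - (b + d)
  lem = solve-∀
ev-dd s (scl c q) x = begin
  α s x * (c * ev (dd s q) x)       ≡⟨ lem₁ (α s x) c (ev (dd s q) x) ⟩
  c * (α s x * ev (dd s q) x)       ≡⟨ cong (c *_) (ev-dd s q x) ⟩
  c * (ev q x - ev q (act s x))     ≡⟨ lem₂ c (ev q x) (ev q (act s x)) ⟩
  c * ev q x - c * ev q (act s x)   ∎
  where
  open ≡-Reasoning
  lem₁ : ∀ a c e → a * (c * e) ≡ c * (a * e)
  lem₁ = solve-∀
  lem₂ : ∀ c e f → c * (e - f) ≡ c * e - c * f
  lem₂ = solve-∀
ev-dd {zero} s (mul v q) x = begin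
  α s x * (κ s v * ev q x)
    ≡⟨ lem (α s x) (κ s v) (x v) (ev q x) ⟩
  x v * ev q x - (x v - κ s v * α s x) * ev q x
    ≡⟨ cong₂ (λ a e → x v * ev q x - a * e) (sym (act-reflects s x v)) (ev-constant q x (act s x)) ⟩
  x v * ev q x - act s x v * ev q (act s x) ∎
  where
  open ≡-Reasoning
  lem : ∀ a k b e → a * (k * e) ≡ b * e - (b - k * a) * e
  lem = solve-∀
ev-dd {suc n} s (mul v q) x = begin
  α s x * (x v * ev (dd s q) x + κ s v * ev (pull s q) x)
    ≡⟨ lem₁ (α s x) (x v) (ev (dd s q) x) (κ s v) (ev (pull s q) x) ⟩
  x v * (α s x * ev (dd s q) x) + κ s v * α s x * ev (pull s q) x
    ≡⟨ cong₂ (λ d e → x v * d + κ s v * α s x * e) (ev-dd s q x) (ev-pull s q x) ⟩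
  x v * (ev q x - ev q (act s x)) + κ s v * α s x * ev q (act s x)
    ≡⟨ lem₂ (x v) (ev q x) (ev q (act s x)) (κ s v * α s x) ⟩
  x v * ev q x - (x v - κ s v * α s x) * ev q (act s x)
    ≡⟨ cong (λ a → x v * ev q x - a * ev q (act s x)) (sym (act-reflects s x v)) ⟩
  x v * ev q x - act s x v * ev q (act s x) ∎
  where
  open ≡-Reasoning
  lem₁ : ∀ a b d k e → a * (b * d + k * e) ≡ b * (a * d) + k * a * e
  lem₁ = solve-∀
  lem₂ : ∀ b e f c → b * (e - f) + c * f ≡ b * e - (b - c) * f
  lem₂ = solve-∀

-- Configurations and their values.

Config : Set
Config = Site → Bool

move : Site → Config → Config
move (zero  , j) ε t with t ≟ₛ (0 , j)
... | yes _ = not (ε t)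
... | no _  = ε t
move (suc i , j) ε t = ε (swap i j t)

swap-upper : ∀ i j → swap i j (suc i , j) ≡ (i , j)
swap-upper i j with (suc i , j) ≟ₛ (suc i , j)
... | yes _ = refl
... | no ≢  = ⊥-elim (≢ refl)

swap-lower : ∀ i j → swap i j (i , j) ≡ (suc i , j)
swap-lower i j with (i , j) ≟ₛ (suc i , j) | (i , j) ≟ₛ (i , j)
... | yes () | _
... | no _   | yes _ = refl
... | no _   | no ≢  = ⊥-elim (≢ refl)

swap-other : ∀ i j {t} → t ≢ (suc i , j) → t ≢ (i , j) → swap i j t ≡ t
swap-other i j {t} ≢u ≢l with t ≟ₛ (suc i , j) | t ≟ₛ (i , j)
... | yes ≡u | _      = ⊥-elim (≢u ≡u)
... | no _   | yes ≡l = ⊥-elim (≢l ≡l)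
... | no _   | no _   = refl

swap-involutive : ∀ i j t → swap i j (swap i j t) ≡ t
swap-involutive i j t with t ≟ₛ (suc i , j) | t ≟ₛ (i , j)
... | yes refl | _        = swap-lower i j
... | no _     | yes refl = swap-upper i j
... | no ≢u    | no ≢l    = swap-other i j ≢u ≢l

swap-row : ∀ i j t → proj₂ (swap i j t) ≡ proj₂ t
swap-row i j t with t ≟ₛ (suc i , j) | t ≟ₛ (i , j)
... | yes refl | _        = refl
... | no _     | yes refl = refl
... | no _     | no _     = refl

move-flip-self : ∀ j ε → move (0 , j) ε (0 , j) ≡ not (ε (0 , j))
move-flip-self j ε with (0 , j) ≟ₛ (0 , j)
... | yes _ = refl
... | no ≢  = ⊥-elim (≢ refl)

move-flip-other : ∀ j ε {t} → t ≢ (0 , j) → move (0 , j) ε t ≡ ε t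
move-flip-other j ε {t} ≢s with t ≟ₛ (0 , j)
... | yes ≡s = ⊥-elim (≢s ≡s)
... | no _   = refl

flip-self : ∀ s a → flip s s a ≡ - a
flip-self s a with s ≟ₛ s
... | yes _ = refl
... | no ≢  = ⊥-elim (≢ refl)

flip-other : ∀ s {t} a → t ≢ s → flip s t a ≡ a
flip-other s {t} a ≢s with t ≟ₛ s
... | yes ≡s = ⊥-elim (≢s ≡s)
... | no _   = refl

flip-square : ∀ s t a → flip s t a * flip s t a ≡ a * a
flip-square s t a with t ≟ₛ s
... | yes _ = lem a
  where
  lem : ∀ a → - a * - a ≡ a * a
  lem = solve-∀
... | no _ = refl

sumOver : List Site → (Site → ℤ) → ℤ
sumOver []       f = 0ℤ
sumOver (t ∷ ts) f = f t + sumOver ts f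

sumOver-cong : ∀ {ts} {f g : Site → ℤ} → All (λ t → f t ≡ g t) ts → sumOver ts f ≡ sumOver ts g
sumOver-cong []       = refl
sumOver-cong (e ∷ es) = cong₂ _+_ e (sumOver-cong es)

sumOver-update : ∀ {ts s} (f g : Site → ℤ) → Unique ts → s ∈ ts →
  (∀ {t} → t ≢ s → g t ≡ f t) → sumOver ts g ≡ sumOver ts f + (g s - f s)
sumOver-update {t ∷ ts} f g (t∉ ∷ _) (here refl) eq = begin
  g t + sumOver ts g  ≡⟨ cong (_+_ (g t)) (sumOver-cong (All.map (λ t≢ → eq (λ e → t≢ (sym e))) t∉)) ⟩
  g t + sumOver ts f  ≡⟨ lem (g t) (f t) (sumOver ts f) ⟩
  f t + sumOver ts f + (g t - f t) ∎
  where
  open ≡-Reasoning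
  lem : ∀ a b c → a + c ≡ b + c + (a - b)
  lem = solve-∀
sumOver-update {t ∷ ts} {s} f g (t∉ ∷ u) (there s∈) eq = begin
  g t + sumOver ts g                 ≡⟨ cong₂ _+_ (eq (All.lookup t∉ s∈)) (sumOver-update f g u s∈ eq) ⟩
  f t + (sumOver ts f + (g s - f s)) ≡⟨ sym (+-assoc (f t) (sumOver ts f) (g s - f s)) ⟩
  f t + sumOver ts f + (g s - f s)   ∎
  where open ≡-Reasoning

sumOver-update₂ : ∀ {ts s r} (f g : Site → ℤ) → Unique ts → s ∈ ts → r ∈ ts → s ≢ r →
  (∀ {t} → t ≢ s → t ≢ r → g t ≡ f t) →
  sumOver ts g ≡ sumOver ts f + (g s - f s) + (g r - f r)
sumOver-update₂ {ts} {s} {r} f g u s∈ r∈ s≢r eq = begin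
  sumOver ts g
    ≡⟨ sumOver-update h g u r∈ h-g ⟩
  sumOver ts h + (g r - h r)
    ≡⟨ cong₂ (λ a b → a + (g r - b)) (sumOver-update f h u s∈ h-f) (h-f (λ e → s≢r (sym e))) ⟩
  sumOver ts f + (h s - f s) + (g r - f r)
    ≡⟨ cong (λ a → sumOver ts f + (a - f s) + (g r - f r)) h-self ⟩
  sumOver ts f + (g s - f s) + (g r - f r) ∎
  where
  open ≡-Reasoning
  -- The intermediate function takes the new value at `s` only, so that two single updates lead from
  -- `f` to `g`.
  h : Site → ℤ
  h t with t ≟ₛ s
  ... | yes _ = g t
  ... | no _  = f t
  h-self : h s ≡ g s
  h-self with s ≟ₛ s
  ... | yes _ = refl
  ... | no ≢  = ⊥-elim (≢ refl)
  h-f : ∀ {t} → t ≢ s → h t ≡ f t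
  h-f {t} ≢s with t ≟ₛ s
  ... | yes ≡s = ⊥-elim (≢s ≡s)
  ... | no _   = refl
  h-g : ∀ {t} → t ≢ r → g t ≡ h t
  h-g {t} ≢r with t ≟ₛ s
  ... | yes _ = refl
  ... | no ≢s = eq ≢s ≢r

sel : Bool → ℤ → ℤ
sel true  a = a
sel false a = 0ℤ

selSum : List Site → Config → State → ℤ
selSum ts ε x = sumOver ts (λ t → sel (ε t) (x (elt t)))

value : List Site → Config → State → ℤ
value ts ε x = x base + selSum ts ε x

-- Each row is an initial segment, so both sites exchanged by a swap lie in `ts`.
DownClosed : List Site → Set
DownClosed ts = ∀ {i j} → (suc i , j) ∈ ts → (i , j) ∈ ts

swap-∈ : ∀ {ts} → DownClosed ts → ∀ {i j} → (suc i , j) ∈ ts → ∀ {t} → t ∈ ts → swap i j t ∈ ts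
swap-∈ closed {i} {j} s∈ {t} t∈ with t ≟ₛ (suc i , j) | t ≟ₛ (i , j)
... | yes _ | _     = closed s∈
... | no _  | yes _ = s∈
... | no _  | no _  = t∈

module _ {ts : List Site} (unique : Unique ts) (closed : DownClosed ts) where

  -- Negating an entry while adding it to the base exchanges selecting and omitting it; a swap of
  -- entries amounts to a swap of choices. Thus reflections permute the set of values.
  value-act : ∀ {s} → s ∈ ts → ∀ ε x → value ts ε (act s x) ≡ value ts (move s ε) x
  value-act {zero , j} s∈ ε x = begin
    x base + x (elt s) + sumOver ts f
      ≡⟨ lem₁ (x base) (x (elt s)) (sumOver ts f) ⟩
    x base + (sumOver ts f + x (elt s))
      ≡⟨ cong (λ a → x base + (sumOver ts f + a)) (sym change) ⟩
    x base + (sumOver ts f + (g s - f s))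
      ≡⟨ cong (_+_ (x base)) (sym (sumOver-update f g unique s∈ same)) ⟩
    x base + sumOver ts g ∎
    where
    open ≡-Reasoning
    s = (0 , j)
    f g : Site → ℤ
    f t = sel (ε t) (flip s t (x (elt t)))
    g t = sel (move s ε t) (x (elt t))
    lem₁ : ∀ a b c → a + b + c ≡ a + (c + b)
    lem₁ = solve-∀
    same : ∀ {t} → t ≢ s → g t ≡ f t
    same {t} ≢s = cong₂ sel (move-flip-other j ε ≢s) (sym (flip-other s (x (elt t)) ≢s))
    sel-not : ∀ b a → sel (not b) a - sel b (- a) ≡ a
    sel-not true  = on
      where
      on : ∀ a → 0ℤ - - a ≡ a
      on = solve-∀
    sel-not false = off
      where
      off : ∀ a → a - 0ℤ ≡ a
      off = solve-∀
    change : g s - f s ≡ x (elt s)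
    change = trans (cong₂ (λ b a → sel b (x (elt s)) - sel (ε s) a) (move-flip-self j ε) (flip-self s (x (elt s))))
                   (sel-not (ε s) (x (elt s)))
  value-act {suc i , j} s∈ ε x = cong (_+_ (x base)) (begin
    sumOver ts f                                 ≡⟨ lem (sumOver ts f) (f s) (f r) ⟩
    sumOver ts f + (f r - f s) + (f s - f r)     ≡⟨ sym (cong₂ (λ a b → sumOver ts f + (a - f s) + (b - f r)) gs gr) ⟩
    sumOver ts f + (g s - f s) + (g r - f r)     ≡⟨ sym (sumOver-update₂ f g unique s∈ (closed s∈) (λ ()) same) ⟩
    sumOver ts g                                 ∎)
    where
    open ≡-Reasoning
    s = (suc i , j)
    r = (i , j)
    f g : Site → ℤ
    f t = sel (ε t) (x (elt (swap i j t)))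
    g t = sel (ε (swap i j t)) (x (elt t))
    lem : ∀ a b c → a ≡ a + (c - b) + (b - c)
    lem = solve-∀
    g-f : ∀ {t t′} → swap i j t ≡ t′ → swap i j t′ ≡ t → g t ≡ f t′
    g-f e e′ = cong₂ (λ a b → sel (ε a) (x (elt b))) e (sym e′)
    gs : g s ≡ f r
    gs = g-f (swap-upper i j) (swap-lower i j)
    gr : g r ≡ f s
    gr = g-f (swap-lower i j) (swap-upper i j)
    same : ∀ {t} → t ≢ s → t ≢ r → g t ≡ f t
    same ≢s ≢r = g-f (swap-other i j ≢s ≢r) (swap-other i j ≢s ≢r)

-- Products over the zeros, words of divided differences, nondegeneracy.

rootProd : ℕ → State → ℤ → ℤ
rootProd zero    x b = 1ℤ
rootProd (suc n) x b = (b - x (root n)) * rootProd n x b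

rootProd-act : ∀ n s x b → rootProd n (act s x) b ≡ rootProd n x b
rootProd-act zero    s           x b = refl
rootProd-act (suc n) (zero  , j) x b = cong ((b - x (root n)) *_) (rootProd-act n (zero , j) x b)
rootProd-act (suc n) (suc i , j) x b = cong ((b - x (root n)) *_) (rootProd-act n (suc i , j) x b)

rootPol : ∀ n → Pol n
rootPol zero    = con 1ℤ
rootPol (suc n) = add (mul base (rootPol n)) (scl -1ℤ (mul (root n) (rootPol n)))

ev-rootPol : ∀ n x → ev (rootPol n) x ≡ rootProd n x (x base)
ev-rootPol zero    x = refl
ev-rootPol (suc n) x = trans (lem (x base) (x (root n)) (ev (rootPol n) x))
                             (cong ((x base - x (root n)) *_) (ev-rootPol n x))
  where
  lem : ∀ a b c → a * c + -1ℤ * (b * c) ≡ (a - b) * c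
  lem = solve-∀

-- This is `length w + k`, but with the recursion of `ddWord`, so that the degrees agree
-- definitionally.
rootCount : List Site → ℕ → ℕ
rootCount []      k = k
rootCount (s ∷ w) k = rootCount w (suc k)

rootCount-+ : ∀ w k → rootCount w k ≡ length w ℕ.+ k
rootCount-+ []      k = refl
rootCount-+ (s ∷ w) k = trans (rootCount-+ w (suc k)) (ℕ.+-suc (length w) k)

ddWord : List Site → ∀ k → Pol k
ddWord []      k = rootPol k
ddWord (s ∷ w) k = dd s (ddWord w (suc k))

-- Unlike `Prime`, this admits 0, where divisibility means being zero. One vanishing lemma then
-- serves both modulo p and over the integers.
Prime∣ : ℤ → Set
Prime∣ n = ∀ {a b} → n ∣ a * b → n ∣ a ⊎ n ∣ b

prime∣0 : Prime∣ 0ℤ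
prime∣0 {a} {b} 0∣ with i*j≡0⇒i≡0∨j≡0 a (0∣⇒≡0 0∣)
... | inj₁ refl = inj₁ (divides 0ℤ refl)
... | inj₂ refl = inj₂ (divides 0ℤ refl)

-- Squares make the condition on x t ≢ ± x t′ manifestly invariant under the reflections.
record Nondegenerate (n : ℤ) (ts : List Site) (x : State) : Set where
  field
    nonzero  : ∀ {t} → t ∈ ts → ¬ n ∣ x (elt t)
    distinct : ∀ {t t′} → t ∈ ts → t′ ∈ ts → proj₂ t ≡ proj₂ t′ → t ≢ t′ →
               ¬ n ∣ x (elt t) * x (elt t) - x (elt t′) * x (elt t′)

open Nondegenerate

none : Config
none _ = false

full : Config
full _ = true

config : List Site → Config
config []      = none
config (s ∷ w) = move s (config w)

value-none : ∀ ts x → value ts none x ≡ x base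
value-none ts x = trans (cong (_+_ (x base)) (zeros ts)) (+-identityʳ (x base))
  where
  zeros : ∀ ts → selSum ts none x ≡ 0ℤ
  zeros []       = refl
  zeros (t ∷ ts) = trans (cong (_+_ 0ℤ) (zeros ts)) refl

-- Heights and the principal state.

weight : Bool → ℕ → ℕ
weight true  n = n
weight false n = 0

height : List Site → Config → ℕ
height []       ε = 0
height (t ∷ ts) ε = weight (ε t) (suc (proj₁ t)) ℕ.+ height ts ε

height-none : ∀ ts → height ts none ≡ 0
height-none []       = refl
height-none (t ∷ ts) = height-none ts

-- At this state the value of a configuration is its height.
principal : State
principal base          = 0ℤ
principal (elt (i , _)) = + suc i
principal (root k)      = + k

value-principal : ∀ ts ε → value ts ε principal ≡ + height ts ε
value-principal ts ε = trans (lem (selSum ts ε principal)) (selSum-principal ts)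
  where
  lem : ∀ a → 0ℤ + a ≡ a
  lem = solve-∀
  sel-pos : ∀ b n → sel b (+ n) ≡ + weight b n
  sel-pos true  n = refl
  sel-pos false n = refl
  selSum-principal : ∀ ts → selSum ts ε principal ≡ + height ts ε
  selSum-principal []       = refl
  selSum-principal (t ∷ ts) = trans
    (cong₂ _+_ (sel-pos (ε t) (suc (proj₁ t))) (selSum-principal ts))
    (sym (pos-+ (weight (ε t) (suc (proj₁ t))) (height ts ε)))

-- The change of height under `move s`. At the principal state the lowest entry is 1 and neighbours
-- in a row differ by 1, so only -1, 0 and 1 occur.
gain : Site → Config → ℤ
gain (zero  , j) ε = sel (not (ε (0 , j))) 1ℤ - sel (ε (0 , j)) 1ℤ
gain (suc i , j) ε = sel (ε (i , j)) 1ℤ - sel (ε (suc i , j)) 1ℤ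

module _ {ts : List Site} (unique : Unique ts) (closed : DownClosed ts) where

  value-move-principal : ∀ {s} → s ∈ ts → ∀ ε →
    value ts (move s ε) principal ≡ value ts ε principal + gain s ε
  value-move-principal {zero , j} s∈ ε = begin
    0ℤ + sumOver ts g               ≡⟨ cong (_+_ 0ℤ) (sumOver-update f g unique s∈ same) ⟩
    0ℤ + (sumOver ts f + (g s - f s)) ≡⟨ cong (λ b → 0ℤ + (sumOver ts f + (sel b 1ℤ - f s))) (move-flip-self j ε) ⟩
    0ℤ + (sumOver ts f + gain s ε)  ≡⟨ sym (+-assoc 0ℤ (sumOver ts f) (gain s ε)) ⟩
    0ℤ + sumOver ts f + gain s ε    ∎
    where
    open ≡-Reasoning
    s = (0 , j)
    f g : Site → ℤ
    f t = sel (ε t) (principal (elt t))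
    g t = sel (move s ε t) (principal (elt t))
    same : ∀ {t} → t ≢ s → g t ≡ f t
    same {t} ≢s = cong (λ b → sel b (principal (elt t))) (move-flip-other j ε ≢s)
  value-move-principal {suc i , j} s∈ ε = begin
    0ℤ + sumOver ts g
      ≡⟨ cong (_+_ 0ℤ) (sumOver-update₂ f g unique s∈ (closed s∈) (λ ()) same) ⟩
    0ℤ + (sumOver ts f + (g s - f s) + (g r - f r))
      ≡⟨ cong₂ (λ a b → 0ℤ + (sumOver ts f + (sel (ε a) (+ suc (suc i)) - f s) + (sel (ε b) (+ suc i) - f r)))
               (swap-upper i j) (swap-lower i j) ⟩
    0ℤ + (sumOver ts f + (sel (ε r) (+ suc (suc i)) - f s) + (sel (ε s) (+ suc i) - f r))
      ≡⟨ lem (ε r) (ε s) (sumOver ts f) (+ suc i) ⟩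
    0ℤ + sumOver ts f + gain s ε ∎
    where
    open ≡-Reasoning
    s = (suc i , j)
    r = (i , j)
    f g : Site → ℤ
    f t = sel (ε t) (principal (elt t))
    g t = sel (move s ε t) (principal (elt t))
    same : ∀ {t} → t ≢ s → t ≢ r → g t ≡ f t
    same {t} ≢s ≢r = cong (λ b → sel (ε b) (principal (elt t))) (swap-other i j ≢s ≢r)
    lem : ∀ b c a h → 0ℤ + (a + (sel b (1ℤ + h) - sel c (1ℤ + h)) + (sel c h - sel b h)) ≡ 0ℤ + a + (sel b 1ℤ - sel c 1ℤ)
    lem true  true  = eq
      where
      eq : ∀ a h → 0ℤ + (a + (1ℤ + h - (1ℤ + h)) + (h - h)) ≡ 0ℤ + a + (1ℤ - 1ℤ)
      eq = solve-∀
    lem true  false = eq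
      where
      eq : ∀ a h → 0ℤ + (a + (1ℤ + h - 0ℤ) + (0ℤ - h)) ≡ 0ℤ + a + (1ℤ - 0ℤ)
      eq = solve-∀
    lem false true  = eq
      where
      eq : ∀ a h → 0ℤ + (a + (0ℤ - (1ℤ + h)) + (h - 0ℤ)) ≡ 0ℤ + a + (0ℤ - 1ℤ)
      eq = solve-∀
    lem false false = eq
      where
      eq : ∀ a (h : ℤ) → 0ℤ + (a + (0ℤ - 0ℤ) + (0ℤ - 0ℤ)) ≡ 0ℤ + a + (0ℤ - 0ℤ)
      eq = solve-∀

  height-move : ∀ {s} → s ∈ ts → ∀ ε → + height ts (move s ε) ≡ + height ts ε + gain s ε
  height-move {s} s∈ ε = trans (sym (value-principal ts (move s ε)))
    (trans (value-move-principal s∈ ε) (cong (_+ gain s ε) (value-principal ts ε)))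

  -- Consequently m moves from the empty configuration reach height at most m, which is why
  -- vanishing is only ever required up to the length of the word.
  height-move-≤ : ∀ {s} → s ∈ ts → ∀ ε → height ts (move s ε) ≤ suc (height ts ε)
  height-move-≤ {s} s∈ ε = bound (gain-cases s) (height-move s∈ ε)
    where
    gain-cases : ∀ s → gain s ε ≡ 1ℤ ⊎ gain s ε ≡ 0ℤ ⊎ gain s ε ≡ -1ℤ
    gain-cases (zero , j) with ε (0 , j)
    ... | true  = inj₂ (inj₂ refl)
    ... | false = inj₁ refl
    gain-cases (suc i , j) with ε (i , j) | ε (suc i , j)
    ... | true  | true  = inj₂ (inj₁ refl)
    ... | true  | false = inj₁ refl
    ... | false | true  = inj₂ (inj₂ refl)
    ... | false | false = inj₂ (inj₁ refl)
    bound : ∀ {g a b} → g ≡ 1ℤ ⊎ g ≡ 0ℤ ⊎ g ≡ -1ℤ → + a ≡ + b + g → a ≤ suc b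
    bound {b = b} (inj₁ refl) e = ℕ.≤-reflexive (trans (+-injective e) (ℕ.+-comm b 1))
    bound {b = b} (inj₂ (inj₁ refl)) e =
      ℕ.m≤n⇒m≤1+n (ℕ.≤-reflexive (trans (+-injective e) (ℕ.+-identityʳ b)))
    bound {a = a} {b} (inj₂ (inj₂ refl)) e = ℕ.m≤n⇒m≤1+n (ℕ.≤-trans (ℕ.n≤1+n a) (ℕ.≤-reflexive (+-injective
      (trans (cong (_+_ 1ℤ) e) (lem (+ b))))))
      where
      lem : ∀ b → 1ℤ + (b + -1ℤ) ≡ b
      lem = solve-∀

  -- From an unselected site, descend along its row until the next lower site is selected or the
  -- bottom is reached. Swapping, respectively flipping, there gains exactly 1.
  raise : ∀ ε i j → (i , j) ∈ ts → ε (i , j) ≡ false →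
    ∃ λ s → s ∈ ts × height ts (move s ε) ≡ suc (height ts ε)
  raise ε i j t∈ off = _ , proj₁ (proj₂ (site i t∈ off)) ,
    trans (+-injective (trans (height-move (proj₁ (proj₂ (site i t∈ off))) ε)
                              (cong (_+_ (+ height ts ε)) (proj₂ (proj₂ (site i t∈ off))))))
          (ℕ.+-comm (height ts ε) 1)
    where
    site : ∀ i → (i , j) ∈ ts → ε (i , j) ≡ false → ∃ λ s → s ∈ ts × gain s ε ≡ 1ℤ
    site zero    t∈ off = (0 , j) , t∈ , cong (λ b → sel (not b) 1ℤ - sel b 1ℤ) off
    site (suc i) t∈ off with ε (i , j) in below
    ... | true  = (suc i , j) , t∈ , cong₂ (λ b c → sel b 1ℤ - sel c 1ℤ) below off
    ... | false = site i (closed t∈) below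

unfilled : ∀ {ts} ε → height ts ε < height ts full → ∃ λ t → t ∈ ts × ε t ≡ false
unfilled {[]} ε ()
unfilled {t ∷ ts} ε lt with ε t in eq
... | false = t , here refl , eq
... | true  = let (t′ , t′∈ , off) = unfilled {ts} ε (ℕ.+-cancelˡ-< (suc (proj₁ t)) _ _ lt)
              in t′ , there t′∈ , off

-- Climbing words, vanishing and divisibility.

module _ {ts : List Site} (unique : Unique ts) (closed : DownClosed ts) where

  -- Greedy choice: below the full height some site is unselected, and `raise` supplies the next
  -- letter.
  word : ∀ m → m ≤ height ts full →
    ∃ λ w → All (_∈ ts) w × length w ≡ m × height ts (config w) ≡ m
  word zero    _ = [] , [] , refl , height-none ts
  word (suc m) m<N =
    let (w , w∈ , len , ht)  = word m (ℕ.<⇒≤ m<N)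
        ((i , j) , t∈ , off) = unfilled (config w) (subst (_< height ts full) (sym ht) m<N)
        (s , s∈ , up)        = raise unique closed (config w) i j t∈ off
    in s ∷ w , s∈ ∷ w∈ , cong suc len , trans up (cong suc ht)

  module _ {n : ℤ} where

    -- Sign changes preserve squares, and swaps permute the sites of `ts` within each row.
    act-nondegenerate : ∀ {s} → s ∈ ts → ∀ {x} → Nondegenerate n ts x → Nondegenerate n ts (act s x)
    act-nondegenerate {zero , j} s∈ {x} nd = record
      { nonzero  = λ {t} t∈ n∣ → nonzero nd t∈ (unflip t n∣)
      ; distinct = λ {t} {t′} t∈ t′∈ row t≢ n∣ → distinct nd t∈ t′∈ row t≢
          (subst (n ∣_) (cong₂ _-_ (flip-square (0 , j) t _) (flip-square (0 , j) t′ _)) n∣)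
      }
      where
      lem : ∀ a → - a * -1ℤ ≡ a
      lem = solve-∀
      unflip : ∀ t → n ∣ act (0 , j) x (elt t) → n ∣ x (elt t)
      unflip t n∣ with t ≟ₛ (0 , j)
      ... | yes _ = subst (n ∣_) (lem (x (elt t))) (∣m⇒∣m*n -1ℤ n∣)
      ... | no _  = n∣
    act-nondegenerate {suc i , j} s∈ nd = record
      { nonzero  = λ t∈ → nonzero nd (swap-∈ closed s∈ t∈)
      ; distinct = λ {t} {t′} t∈ t′∈ row t≢ →
          distinct nd (swap-∈ closed s∈ t∈) (swap-∈ closed s∈ t′∈)
            (trans (swap-row i j t) (trans row (sym (swap-row i j t′))))
            (λ e → t≢ (trans (sym (swap-involutive i j t)) (trans (cong (swap i j) e) (swap-involutive i j t′))))
      }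

    -- A difference of neighbours divides the difference of their squares. The lemma allows the
    -- factor `α s x` in `ev-dd` to be cancelled.
    α-nondegenerate : ∀ {s} → s ∈ ts → ∀ {x} → Nondegenerate n ts x → ¬ n ∣ α s x
    α-nondegenerate {zero , j} s∈ {x} nd n∣ = nonzero nd s∈ (subst (n ∣_) (lem (x (elt (0 , j)))) (∣m⇒∣m*n -1ℤ n∣))
      where
      lem : ∀ a → - a * -1ℤ ≡ a
      lem = solve-∀
    α-nondegenerate {suc i , j} s∈ {x} nd n∣ = distinct nd s∈ (closed s∈) refl (λ ())
      (subst (n ∣_) (lem (x (elt (suc i , j))) (x (elt (i , j)))) (∣m⇒∣m*n _ n∣))
      where
      lem : ∀ a b → (a - b) * (a + b) ≡ a * a - b * b
      lem = solve-∀

    -- By `ev-dd`, `α s x` times the new evaluation is the difference of the evaluations for the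
    -- shorter word at `x` and at `act s x`. Both are divisible by induction, and `n` does not
    -- divide `α s x`.
    ddWord-vanishes : Prime∣ n → ∀ w → All (_∈ ts) w → ∀ k x → Nondegenerate n ts x →
      (∀ ε → height ts ε ≤ length w → n ∣ rootProd (rootCount w k) x (value ts ε x)) →
      n ∣ ev (ddWord w k) x
    ddWord-vanishes prm [] [] k x nd van = subst (n ∣_)
      (trans (cong (rootProd k x) (value-none ts x)) (sym (ev-rootPol k x)))
      (van none (ℕ.≤-reflexive (height-none ts)))
    ddWord-vanishes prm (s ∷ w) (s∈ ∷ w∈) k x nd van
      with prm {α s x} (subst (n ∣_) (sym (ev-dd s (ddWord w (suc k)) x)) (∣m∣n⇒∣m-n at-x at-sx))
      where
      at-x : n ∣ ev (ddWord w (suc k)) x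
      at-x = ddWord-vanishes prm w w∈ (suc k) x nd (λ ε h → van ε (ℕ.m≤n⇒m≤1+n h))
      -- Values at the reflected state are values at `x` of moved configurations; the possible extra
      -- unit of height is paid for by the letter `s`.
      at-sx : n ∣ ev (ddWord w (suc k)) (act s x)
      at-sx = ddWord-vanishes prm w w∈ (suc k) (act s x) (act-nondegenerate s∈ nd) λ ε h →
        subst (n ∣_) (sym (trans (rootProd-act (rootCount w (suc k)) s x _)
                                 (cong (rootProd (rootCount w (suc k)) x) (value-act unique closed s∈ ε x))))
              (van (move s ε) (ℕ.≤-trans (height-move-≤ unique closed s∈ ε) (s≤s h)))
    ... | inj₁ n∣α = ⊥-elim (α-nondegenerate s∈ nd n∣α)
    ... | inj₂ n∣D = n∣D

  -- Proper subwords of w only reach configurations of smaller height, so the term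
  -- of w itself is the only one that survives in the iterated difference.
  ddWord-divides : ∀ w → All (_∈ ts) w → ∀ k x → Nondegenerate 0ℤ ts x →
    (∀ ε → height ts ε < length w → rootProd (rootCount w k) x (value ts ε x) ≡ 0ℤ) →
    ev (ddWord w k) x ∣ rootProd (rootCount w k) x (value ts (config w) x)
  ddWord-divides [] [] k x nd van = divides 1ℤ
    (trans (cong (rootProd k x) (value-none ts x)) (trans (sym (ev-rootPol k x)) (lem (ev (rootPol k) x))))
    where
    lem : ∀ a → a ≡ 1ℤ * a
    lem = solve-∀
  ddWord-divides (s ∷ w) (s∈ ∷ w∈) k x nd van =
    -- The evaluation at `x` is zero, so `ev-dd` expresses the evaluation at `act s x` as `- α s x`
    -- times that of the longer word.
    divides (q * - α s x) (begin
      rootProd m x (value ts (move s (config w)) x)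
        ≡⟨ sym (at-sx (config w)) ⟩
      rootProd m (act s x) (value ts (config w) (act s x))
        ≡⟨ _∣_.equality rec ⟩
      q * ev (ddWord w (suc k)) (act s x)
        ≡⟨ lem₁ q (ev (ddWord w (suc k)) (act s x)) ⟩
      q * - (0ℤ - ev (ddWord w (suc k)) (act s x))
        ≡⟨ cong (λ e → q * - (e - ev (ddWord w (suc k)) (act s x))) (sym at-x) ⟩
      q * - (ev (ddWord w (suc k)) x - ev (ddWord w (suc k)) (act s x))
        ≡⟨ cong (λ e → q * - e) (sym (ev-dd s (ddWord w (suc k)) x)) ⟩
      q * - (α s x * ev (ddWord (s ∷ w) k) x)
        ≡⟨ lem₂ q (α s x) (ev (ddWord (s ∷ w) k) x) ⟩
      q * - α s x * ev (ddWord (s ∷ w) k) x ∎)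
    where
    open ≡-Reasoning
    m = rootCount w (suc k)
    at-sx : ∀ ε → rootProd m (act s x) (value ts ε (act s x)) ≡ rootProd m x (value ts (move s ε) x)
    at-sx ε = trans (rootProd-act m s x _) (cong (rootProd m x) (value-act unique closed s∈ ε x))
    rec : ev (ddWord w (suc k)) (act s x) ∣ rootProd m (act s x) (value ts (config w) (act s x))
    rec = ddWord-divides w w∈ (suc k) (act s x) (act-nondegenerate s∈ nd) λ ε h →
      trans (at-sx ε) (van (move s ε) (s≤s (ℕ.≤-trans (height-move-≤ unique closed s∈ ε) h)))
    q = _∣_.quotient rec
    -- The vanishing lemma over the integers, with n = 0: the word `w` has one letter less, so only
    -- heights below the hypothesis bound occur.
    at-x : ev (ddWord w (suc k)) x ≡ 0ℤ
    at-x = 0∣⇒≡0 (ddWord-vanishes prime∣0 w w∈ (suc k) x nd (λ ε h → divides 0ℤ (van ε (s≤s h))))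
    lem₁ : ∀ q e → q * e ≡ q * - (0ℤ - e)
    lem₁ = solve-∀
    lem₂ : ∀ q a e → q * - (a * e) ≡ q * - a * e
    lem₂ = solve-∀

-- A prime modulus and the comparison of two states.

prime⇒prime∣ : ∀ {p} → Prime p → Prime∣ (+ p)
prime⇒prime∣ {p} pr {a} {b} p∣ with euclidsLemma ℤ.∣ a ∣ ℤ.∣ b ∣ pr (subst (p ℕ.∣_) (abs-* a b) (∣⇒∣ᵤ p∣))
... | inj₁ p∣a = inj₁ (∣ᵤ⇒∣ p∣a)
... | inj₂ p∣b = inj₂ (∣ᵤ⇒∣ p∣b)

square-injective : ∀ m n → m ℕ.* m ≡ n ℕ.* n → m ≡ n
square-injective m n e with ℕ.<-cmp m n
... | tri< m<n _ _ = ⊥-elim (ℕ.<⇒≢ (ℕ.*-mono-< m<n m<n) e)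
... | tri≈ _ m≡n _ = m≡n
... | tri> _ _ n<m = ⊥-elim (ℕ.<⇒≢ (ℕ.*-mono-< n<m n<m) (sym e))

principal-nondegenerate : ∀ ts → Nondegenerate 0ℤ ts principal
principal-nondegenerate ts = record
  { nonzero  = λ _ 0∣ → case0 (0∣⇒≡0 0∣)
  ; distinct = λ { {i , j} {i′ , .j} _ _ refl t≢ 0∣ → t≢ (cong (_, j) (ℕ.suc-injective
      (square-injective (suc i) (suc i′) (+-injective (i-j≡0⇒i≡j _ _ (0∣⇒≡0 0∣)))))) }
  }
  where
  case0 : ∀ {n} → + suc n ≢ 0ℤ
  case0 ()

-- The product is the falling factorial h (h - 1) ⋯ (h - n + 1), which for h < n contains the factor
-- 0.
rootProd-principal : ∀ {h n} → h < n → rootProd n principal (+ h) ≡ 0ℤ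
rootProd-principal {h} {suc n} h<1+n with h ℕ.≟ n
... | yes refl = cong (_* rootProd n principal (+ h)) (i≡j⇒i-j≡0 {+ n} refl)
... | no h≢n   = trans (cong ((+ h - + n) *_) (rootProd-principal (ℕ.≤∧≢⇒< (ℕ.≤-pred h<1+n) h≢n)))
                       (lem (+ h - + n))
  where
  lem : ∀ a → a * 0ℤ ≡ 0ℤ
  lem = solve-∀

∣m-n∣⇒≡ : ∀ {p m n} → m < p → n ≤ m → + p ∣ + m - + n → m ≡ n
∣m-n∣⇒≡ {p} {m} {n} m<p n≤m p∣ with m ℕ.∸ n in e
... | zero  = ℕ.≤-antisym (ℕ.m∸n≡0⇒m≤n e) n≤m
... | suc d = ⊥-elim (ℕ.<⇒≱ m<p (ℕ.≤-trans (ℕ.∣⇒≤ p∣d) (subst (_≤ m) e (ℕ.m∸n≤m m n))))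
  where
  p∣d : p ℕ.∣ suc d
  p∣d = subst (λ z → p ℕ.∣ ℤ.∣ z ∣) (trans (m-n≡m⊖n m n) (trans (⊖-≥ n≤m) (cong +_ e))) (∣⇒∣ᵤ p∣)

-- All factors m - k with k < n ≤ m lie between 1 and m, hence below p. The case n = m says that p
-- does not divide m!.
p∤rootProd-principal : ∀ {p m} → Prime p → m < p → ∀ n → n ≤ m →
  ¬ + p ∣ rootProd n principal (+ m)
p∤rootProd-principal pr m<p zero    _   p∣ = ¬prime[1] (subst Prime (ℕ.∣1⇒≡1 (∣⇒∣ᵤ p∣)) pr)
p∤rootProd-principal {p} {m} pr m<p (suc n) n<m p∣ with prime⇒prime∣ pr {+ m - + n} p∣
... | inj₁ p∣m-n = ℕ.<⇒≢ n<m (sym (∣m-n∣⇒≡ m<p (ℕ.<⇒≤ n<m) p∣m-n))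
... | inj₂ p∣r   = p∤rootProd-principal pr m<p n (ℕ.<⇒≤ n<m) p∣r

module _ {ts : List Site} (unique : Unique ts) (closed : DownClosed ts) where

  too-few-roots : ∀ {p m} → Prime p → m < p → m ≤ height ts full →
    ∀ {x} → Nondegenerate (+ p) ts x →
    ¬ (∀ ε → height ts ε ≤ m → + p ∣ rootProd m x (value ts ε x))
  too-few-roots {p} {m} pr m<p m≤N {x} nd van with word unique closed m m≤N
  ... | w , w∈ , refl , ht = p∤rootProd-principal pr m<p m ℕ.≤-refl
    (∣-trans p∣D (subst (ev (ddWord w 0) principal ∣_)
       (cong₂ (λ c v → rootProd c principal v) count (trans (value-principal ts (config w)) (cong +_ ht)))
       (ddWord-divides unique closed w w∈ 0 principal (principal-nondegenerate ts) λ ε h →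
         trans (cong₂ (λ c v → rootProd c principal v) count (value-principal ts ε)) (rootProd-principal h))))
    where
    count : rootCount w 0 ≡ m
    count = trans (rootCount-+ w 0) (ℕ.+-identityʳ (length w))
    p∣D : + p ∣ ev (ddWord w 0) principal
    -- Degree 0 is reached, so the constant found divisible at `x` is the same one at the principal
    -- state.
    p∣D = subst (+ p ∣_) (ev-constant (ddWord w 0) x principal)
      (ddWord-vanishes unique closed (prime⇒prime∣ pr) w w∈ 0 x nd λ ε h →
        subst (λ c → + p ∣ rootProd c x (value ts ε x)) (sym count) (van ε h))

-- Subset sums of residues as values of configurations.

nthℤ : ∀ {p} → List (Fin p) → ℕ → ℤ
nthℤ []       k       = 0ℤ
nthℤ (z ∷ zs) zero    = + toℕ z
nthℤ (z ∷ zs) (suc k) = nthℤ zs k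

nthℤ-∈ : ∀ {p} {z : Fin p} {zs} → z ∈ zs → ∃ λ k → k < length zs × nthℤ zs k ≡ + toℕ z
nthℤ-∈ (here refl) = 0 , s≤s z≤n , refl
nthℤ-∈ (there z∈)  = let (k , k< , e) = nthℤ-∈ z∈ in suc k , s≤s k< , e

∣rootProd : ∀ {q k n} x b → k < n → q ∣ b - x (root k) → q ∣ rootProd n x b
∣rootProd {q} {k} {suc n} x b k<1+n q∣ with k ℕ.≟ n
... | yes refl = ∣m⇒∣m*n (rootProd n x b) q∣
... | no k≢n   = ∣n⇒∣m*n (b - x (root n)) (∣rootProd x b (ℕ.≤∧≢⇒< (ℕ.≤-pred k<1+n) k≢n) q∣)

module _ (p : ℕ) .{{_ : NonZero p}} where

  ∣-mod : ∀ n → + p ∣ + n - + toℕ (n mod p)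
  ∣-mod n = divides (+ (n / p)) (begin
    + n - + toℕ (n mod p)
      ≡⟨ cong₂ (λ a b → + a - + b) (m≡m%n+[m/n]*n n p) (toℕ-fromℕ< (m%n<n n p)) ⟩
    + (n % p ℕ.+ n / p ℕ.* p) - + (n % p)
      ≡⟨ cong (λ a → a - + (n % p)) (trans (pos-+ (n % p) (n / p ℕ.* p)) (cong (_+_ (+ (n % p))) (pos-* (n / p) p))) ⟩
    + (n % p) + + (n / p) * + p - + (n % p)
      ≡⟨ lem (+ (n % p)) (+ (n / p) * + p) ⟩
    + (n / p) * + p ∎)
    where
    open ≡-Reasoning
    lem : ∀ a b → a + b - a ≡ b
    lem = solve-∀

  toℕ-zeroₚ : toℕ (zeroₚ p) ≡ 0
  toℕ-zeroₚ = trans (toℕ-fromℕ< (m%n<n 0 p)) (m<n⇒m%n≡m (ℕ.>-nonZero⁻¹ p))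

  +ₚ-identityʳ : ∀ z → _+ₚ_ p z (zeroₚ p) ≡ z
  +ₚ-identityʳ z = toℕ-injective (begin
    toℕ ((toℕ z ℕ.+ toℕ (zeroₚ p)) mod p) ≡⟨ toℕ-fromℕ< (m%n<n _ p) ⟩
    (toℕ z ℕ.+ toℕ (zeroₚ p)) % p         ≡⟨ cong (λ a → (toℕ z ℕ.+ a) % p) toℕ-zeroₚ ⟩
    (toℕ z ℕ.+ 0) % p                     ≡⟨ cong (_% p) (ℕ.+-identityʳ (toℕ z)) ⟩
    toℕ z % p                             ≡⟨ m<n⇒m%n≡m (toℕ<n z) ⟩
    toℕ z                                 ∎)
    where open ≡-Reasoning

  module _ (val : Site → Fin p) where

    complementSum : Config → List Site → Fin p
    complementSum ε [] = zeroₚ p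
    complementSum ε (t ∷ ts) with ε t
    ... | true  = complementSum ε ts
    ... | false = _+ₚ_ p (val t) (complementSum ε ts)

    complementSum-∈ : ∀ ε ts → complementSum ε ts ∈ subsetSums p (map val ts)
    complementSum-∈ ε [] = here refl
    complementSum-∈ ε (t ∷ ts) with ε t
    ... | true  = ∈-++⁺ˡ (complementSum-∈ ε ts)
    ... | false = ∈-++⁺ʳ (subsetSums p (map val ts)) (∈-map⁺ (_+ₚ_ p (val t)) (complementSum-∈ ε ts))

    -- Only an empty complement can escape the nonempty sums. The equation with `zeroₚ` is carried
    -- along because a one-element sum is listed as s, while the complement sum produces s + 0.
    complementSum-∈* : ∀ ε ts → (complementSum ε ts ≡ zeroₚ p × All (λ t → ε t ≡ true) ts)
                              ⊎ complementSum ε ts ∈ subsetSums* p (map val ts)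
    complementSum-∈* ε [] = inj₁ (refl , [])
    complementSum-∈* ε (t ∷ ts) with ε t in eq | complementSum-∈* ε ts
    ... | true  | inj₁ (z , all) = inj₁ (z , eq ∷ all)
    ... | true  | inj₂ ∈Σ        = inj₂ (∈-++⁺ˡ ∈Σ)
    ... | false | inj₁ (z , _)   = inj₂ (∈-++⁺ʳ (subsetSums* p (map val ts))
                                     (here (trans (cong (_+ₚ_ p (val t)) z) (+ₚ-identityʳ (val t)))))
    ... | false | inj₂ ∈Σ        = inj₂ (∈-++⁺ʳ (subsetSums* p (map val ts))
                                     (there (∈-map⁺ (_+ₚ_ p (val t)) ∈Σ)))

    -- The base point is the full sum and every entry is negated, so that a
    -- configuration evaluates to the sum over its complement and the empty
    -- sum is attained only at the top height.
    residueState : List Site → List (Fin p) → State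
    residueState ts zs base     = sumOver ts (λ t → + toℕ (val t))
    residueState ts zs (elt t)  = - (+ toℕ (val t))
    residueState ts zs (root k) = nthℤ zs k

    value-residue : ∀ ε ts zs → + p ∣ value ts ε (residueState ts zs) - + toℕ (complementSum ε ts)
    value-residue ε ts zs = go ts
      where
      total chosen : List Site → ℤ
      total  ts = sumOver ts (λ t → + toℕ (val t))
      chosen ts = sumOver ts (λ t → sel (ε t) (- (+ toℕ (val t))))
      -- The base point depends on the whole list, so the induction runs over the total and the
      -- chosen part together instead of over states.
      go : ∀ ts → + p ∣ total ts + chosen ts - + toℕ (complementSum ε ts)
      go [] = subst (λ a → + p ∣ 0ℤ + 0ℤ - + a) (sym toℕ-zeroₚ) (divides 0ℤ refl)
      go (t ∷ ts) with ε t
      ... | true  = subst (+ p ∣_) (lem (+ toℕ (val t)) (total ts) (chosen ts) (+ toℕ (complementSum ε ts))) (go ts)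
        where
        lem : ∀ v a b c → a + b - c ≡ v + a + (- v + b) - c
        lem = solve-∀
      ... | false = subst (+ p ∣_)
        (trans (cong (λ a → total ts + chosen ts - + r + (a - + toℕ (_+ₚ_ p (val t) (complementSum ε ts))))
                     (pos-+ (toℕ (val t)) r))
               (lem (+ toℕ (val t)) (total ts) (chosen ts) (+ r) _))
        (∣m∣n⇒∣m+n (go ts) (∣-mod (toℕ (val t) ℕ.+ r)))
        where
        r = toℕ (complementSum ε ts)
        lem : ∀ v a b c d → a + b - c + (v + c - d) ≡ v + a + (0ℤ + b) - d
        lem = solve-∀

    module _ {ts : List Site} (unique : Unique ts) (closed : DownClosed ts) (pr : Prime p)
             (nd : ∀ zs → Nondegenerate (+ p) ts (residueState ts zs)) where

      -- The distinct elements of `L` serve as the zeros. If `L` contained all these sums, every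
      -- product in `too-few-roots` would have a factor divisible by p.
      card-bound : ∀ L → card p L < p → card p L ≤ height ts full →
        ¬ (∀ ε → height ts ε ≤ card p L → complementSum ε ts ∈ L)
      card-bound L m<p m≤N sums∈ = too-few-roots unique closed pr m<p m≤N (nd zs) λ ε h →
        let (k , k< , e) = nthℤ-∈ (∈-filter⁺ (_∈? L) (∈-allFin _) (sums∈ ε h))
        in ∣rootProd (residueState ts zs) _ k<
             (subst (λ a → + p ∣ value ts ε (residueState ts zs) - a) (sym e) (value-residue ε ts zs))
        where
        open import Data.List.Membership.DecPropositional (_≟_ {p}) using (_∈?_)
        zs = filter (_∈? L) (allFin p)

      |Σ|-bound : |Σ| p (map val ts) ≥ p ⊓ (1 ℕ.+ height ts full)
      |Σ|-bound with p ⊓ (1 ℕ.+ height ts full) ℕ.≤? |Σ| p (map val ts)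
      ... | yes ok = ok
      ... | no ≰   = ⊥-elim (card-bound (subsetSums p (map val ts))
        (ℕ.<-≤-trans (ℕ.≰⇒> ≰) (ℕ.m⊓n≤m p _))
        -- The extra 1 in the bound arises here: a cardinality equal to the full height is still
        -- excluded.
        (ℕ.≤-pred (ℕ.<-≤-trans (ℕ.≰⇒> ≰) (ℕ.m⊓n≤n p _)))
        (λ ε _ → complementSum-∈ ε ts))

      -- Here the cardinality is strictly below the full height, so every configuration considered
      -- omits a site and its complement is nonempty.
      |Σ*|-bound : |Σ*| p (map val ts) ≥ p ⊓ height ts full
      |Σ*|-bound with p ⊓ height ts full ℕ.≤? |Σ*| p (map val ts)
      ... | yes ok = ok
      ... | no ≰   = ⊥-elim (card-bound (subsetSums* p (map val ts))
        (ℕ.<-≤-trans (ℕ.≰⇒> ≰) (ℕ.m⊓n≤m p _)) (ℕ.<⇒≤ m<N) sums∈)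
        where
        m<N : |Σ*| p (map val ts) < height ts full
        m<N = ℕ.<-≤-trans (ℕ.≰⇒> ≰) (ℕ.m⊓n≤n p _)
        sums∈ : ∀ ε → height ts ε ≤ |Σ*| p (map val ts) → complementSum ε ts ∈ subsetSums* p (map val ts)
        sums∈ ε h with complementSum-∈* ε ts
        ... | inj₂ ∈Σ        = ∈Σ
        ... | inj₁ (_ , all) with unfilled ε (ℕ.≤-<-trans h m<N)
        ...   | t , t∈ , off with () ← trans (sym off) (All.lookup all t∈)

-- Labelling the terms of a sequence by sites.

module Labelling {A : Set} (cls : A → ℕ) where

  count : ℕ → List A → ℕ
  count i [] = 0
  count i (s ∷ S) with cls s ℕ.≟ i
  ... | yes _ = suc (count i S)
  ... | no _  = count i S

  -- Copies are numbered from the end of the list, so labels are unchanged when a term is put in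
  -- front.
  label : A → List A → Site
  label s S = cls s , count (cls s) S

  labels : List A → List Site
  labels []      = []
  labels (s ∷ S) = label s S ∷ labels S

  ∈-labels⁻ : ∀ {S t} → t ∈ labels S → proj₂ t < count (proj₁ t) S
  ∈-labels⁻ {s ∷ S} {t} t∈ with cls s ℕ.≟ proj₁ t | t∈
  ... | yes _ | here refl = ℕ.≤-refl
  ... | no ≢  | here refl = ⊥-elim (≢ refl)
  ... | yes _ | there t∈′ = ℕ.m<n⇒m<1+n (∈-labels⁻ t∈′)
  ... | no _  | there t∈′ = ∈-labels⁻ t∈′

  ∈-labels⁺ : ∀ {S i j} → j < count i S → (i , j) ∈ labels S
  ∈-labels⁺ {s ∷ S} {i} {j} j< with cls s ℕ.≟ i
  ... | no _ = there (∈-labels⁺ j<)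
  ... | yes refl with j ℕ.≟ count i S
  ...   | yes refl = here refl
  ...   | no j≢    = there (∈-labels⁺ (ℕ.≤∧≢⇒< (ℕ.≤-pred j<) j≢))

  label-fresh : ∀ s S {t} → t ∈ labels S → t ≢ label s S
  label-fresh s S t∈ refl = ℕ.<-irrefl refl (∈-labels⁻ t∈)

  labels-unique : ∀ S → Unique (labels S)
  labels-unique []      = []
  labels-unique (s ∷ S) = All.tabulate (λ t∈ e → label-fresh s S t∈ (sym e)) ∷ labels-unique S

  -- The labels form a diagram whose column `i` has `count i S` sites; weakly decreasing columns
  -- make every row an initial segment.
  labels-closed : ∀ {S} → (∀ i → count (suc i) S ≤ count i S) → DownClosed (labels S)
  labels-closed dec {i} t∈ = ∈-labels⁺ (ℕ.<-≤-trans (∈-labels⁻ t∈) (dec i))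

  module _ (d : A) where

    val : List A → Site → A
    val []      t = d
    val (s ∷ S) t with t ≟ₛ label s S
    ... | yes _ = s
    ... | no _  = val S t

    val-head : ∀ s S → val (s ∷ S) (label s S) ≡ s
    val-head s S with label s S ≟ₛ label s S
    ... | yes _ = refl
    ... | no ≢  = ⊥-elim (≢ refl)

    val-tail : ∀ s S {t} → t ∈ labels S → val (s ∷ S) t ≡ val S t
    val-tail s S {t} t∈ with t ≟ₛ label s S
    ... | yes e = ⊥-elim (label-fresh s S t∈ e)
    ... | no _  = refl

    map-val : ∀ S → map (val S) (labels S) ≡ S
    map-val []      = refl
    map-val (s ∷ S) = cong₂ _∷_ (val-head s S)
      (trans (map-cong-local (All.tabulate (val-tail s S))) (map-val S))

    val-∈ : ∀ {S t} → t ∈ labels S → val S t ∈ S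
    val-∈ {s ∷ S} (here refl) = here (val-head s S)
    val-∈ {s ∷ S} (there t∈)  = subst (_∈ s ∷ S) (sym (val-tail s S t∈)) (there (val-∈ t∈))

    cls-val : ∀ {S t} → t ∈ labels S → cls (val S t) ≡ proj₁ t
    cls-val {s ∷ S} (here refl) = cong cls (val-head s S)
    cls-val {s ∷ S} (there t∈)  = trans (cong cls (val-tail s S t∈)) (cls-val t∈)

-- Decreasing lists and weighted sums.

nth : List ℕ → ℕ → ℕ
nth []       i       = 0
nth (l ∷ ls) zero    = l
nth (l ∷ ls) (suc i) = nth ls i

nth-decreasing : ∀ {ls} → AllPairs _≥_ ls → ∀ i → nth ls (suc i) ≤ nth ls i
nth-decreasing []                      i       = z≤n
nth-decreasing ([] ∷ [])               i       = z≤n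
nth-decreasing ((l≥ ∷ _) ∷ _)          zero    = l≥
nth-decreasing (_ ∷ ls↘@(_ ∷ _))       (suc i) = nth-decreasing ls↘ i

reverse-decreasing : ∀ {ls} → AllPairs _≤_ ls → AllPairs _≥_ (reverse ls)
reverse-decreasing []                  = []
reverse-decreasing {l ∷ ls} (l≤ ∷ ls↗) = subst (AllPairs _≥_) (sym (unfold-reverse l ls))
  (AllPairs.++⁺ (reverse-decreasing ls↗) ([] ∷ [])
    (All.map (_∷ []) (All-resp-↭ (↭-sym (↭-reverse ls)) l≤)))

-- The effect on the list of common multiplicities of adding one term of class `i` to the sequence.
bump : ℕ → List ℕ → List ℕ
bump i       []       = []
bump zero    (l ∷ ls) = suc l ∷ ls
bump (suc i) (l ∷ ls) = l ∷ bump i ls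

nth-bump-self : ∀ {i} ls → i < length ls → nth (bump i ls) i ≡ suc (nth ls i)
nth-bump-self {zero}  (l ∷ ls) _        = refl
nth-bump-self {suc i} (l ∷ ls) (s≤s i<) = nth-bump-self ls i<

nth-bump-other : ∀ {i j} ls → i ≢ j → nth (bump i ls) j ≡ nth ls j
nth-bump-other                   []       _  = refl
nth-bump-other {zero}  {zero}    (l ∷ ls) ≢  = ⊥-elim (≢ refl)
nth-bump-other {zero}  {suc j}   (l ∷ ls) _  = refl
nth-bump-other {suc i} {zero}    (l ∷ ls) _  = refl
nth-bump-other {suc i} {suc j}   (l ∷ ls) ≢  = nth-bump-other ls (λ e → ≢ (cong suc e))

-- For k = 1 the increase is `suc i`, the contribution to the height of a new site in column `i`.
weightedSumFrom-bump : ∀ k {i} ls → i < length ls →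
  weightedSumFrom k (bump i ls) ≡ k ℕ.+ i ℕ.+ weightedSumFrom k ls
weightedSumFrom-bump k {zero} (l ∷ ls) _ = begin
  k ℕ.* suc l ℕ.+ w           ≡⟨ cong (ℕ._+ w) (ℕ.*-suc k l) ⟩
  k ℕ.+ k ℕ.* l ℕ.+ w         ≡⟨ ℕ.+-assoc k (k ℕ.* l) w ⟩
  k ℕ.+ (k ℕ.* l ℕ.+ w)       ≡⟨ cong (ℕ._+ (k ℕ.* l ℕ.+ w)) (sym (ℕ.+-identityʳ k)) ⟩
  k ℕ.+ 0 ℕ.+ (k ℕ.* l ℕ.+ w) ∎
  where
  open ≡-Reasoning
  w = weightedSumFrom (suc k) ls
weightedSumFrom-bump k {suc i} (l ∷ ls) (s≤s i<) = begin
  k ℕ.* l ℕ.+ weightedSumFrom (suc k) (bump i ls) ≡⟨ cong (k ℕ.* l ℕ.+_) (weightedSumFrom-bump (suc k) ls i<) ⟩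
  k ℕ.* l ℕ.+ (suc k ℕ.+ i ℕ.+ w)                 ≡⟨ cong (λ n → k ℕ.* l ℕ.+ (n ℕ.+ w)) (sym (ℕ.+-suc k i)) ⟩
  k ℕ.* l ℕ.+ (k ℕ.+ suc i ℕ.+ w)                 ≡⟨ sym (ℕ.+-assoc (k ℕ.* l) (k ℕ.+ suc i) w) ⟩
  k ℕ.* l ℕ.+ (k ℕ.+ suc i) ℕ.+ w                 ≡⟨ cong (ℕ._+ w) (ℕ.+-comm (k ℕ.* l) (k ℕ.+ suc i)) ⟩
  k ℕ.+ suc i ℕ.+ k ℕ.* l ℕ.+ w                   ≡⟨ ℕ.+-assoc (k ℕ.+ suc i) (k ℕ.* l) w ⟩
  k ℕ.+ suc i ℕ.+ (k ℕ.* l ℕ.+ w)                 ∎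
  where
  open ≡-Reasoning
  w = weightedSumFrom (suc k) ls

filter-map : ∀ {A B : Set} {P : B → Set} (P? : ∀ b → Dec (P b)) (f : A → B) xs →
  filter P? (map f xs) ≡ map f (filter (P? ∘ f) xs)
filter-map P? f [] = refl
filter-map P? f (x ∷ xs) with does (P? (f x))
... | true  = cong (f x ∷_) (filter-map P? f xs)
... | false = filter-map P? f xs

-- Pairs of opposite residues, their representatives and multiplicities.

module _ (p : ℕ) .{{_ : NonZero p}} where

  neg : Fin p → Fin p
  neg = -ₚ_ p

  toℕ-neg : ∀ {z} → toℕ z ≢ 0 → toℕ (neg z) ≡ p ∸ toℕ z
  toℕ-neg {z} z≢0 = trans (toℕ-fromℕ< (m%n<n _ p))
    (m<n⇒m%n≡m (ℕ.∸-monoʳ-< {p} {toℕ z} {0} (ℕ.n≢0⇒n>0 z≢0) (ℕ.<⇒≤ (toℕ<n z))))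

  neg-zero : ∀ {z} → toℕ z ≡ 0 → neg z ≡ z
  neg-zero {z} z≡0 = toℕ-injective (begin
    toℕ (neg z)       ≡⟨ toℕ-fromℕ< (m%n<n _ p) ⟩
    (p ∸ toℕ z) % p   ≡⟨ cong (λ a → (p ∸ a) % p) z≡0 ⟩
    p % p             ≡⟨ n%n≡0 p ⟩
    0                 ≡⟨ sym z≡0 ⟩
    toℕ z             ∎)
    where open ≡-Reasoning

  neg-involutive : ∀ z → neg (neg z) ≡ z
  neg-involutive z with toℕ z ℕ.≟ 0
  ... | yes z≡0 = trans (cong neg (neg-zero z≡0)) (neg-zero z≡0)
  ... | no z≢0  = toℕ-injective (begin
    toℕ (neg (neg z)) ≡⟨ toℕ-neg (λ e → ℕ.<⇒≢ (ℕ.m<n⇒0<n∸m (toℕ<n z)) (sym (trans (sym (toℕ-neg z≢0)) e))) ⟩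
    p ∸ toℕ (neg z)   ≡⟨ cong (p ∸_) (toℕ-neg z≢0) ⟩
    p ∸ (p ∸ toℕ z)   ≡⟨ ℕ.m∸[m∸n]≡n (ℕ.<⇒≤ (toℕ<n z)) ⟩
    toℕ z             ∎)
    where open ≡-Reasoning

  Match : Fin p → Fin p → Set
  Match r s = s ≡ r ⊎ s ≡ neg r

  match? : ∀ r s → Dec (Match r s)
  match? r s = (s ≟ r) ⊎-dec (s ≟ neg r)

  match-neg : ∀ {r s} → Match r s → Match r (neg s)
  match-neg (inj₁ refl) = inj₂ refl
  match-neg (inj₂ refl) = inj₁ (neg-involutive _)

  -- The column index of a residue: the position of its pair among the representatives.
  rank : List (Fin p) → Fin p → ℕ
  rank []      s = 0
  rank (r ∷ R) s with match? r s
  ... | yes _ = 0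
  ... | no _  = suc (rank R s)

  rank-neg : ∀ R s → rank R (neg s) ≡ rank R s
  rank-neg []      s = refl
  rank-neg (r ∷ R) s with match? r s | match? r (neg s)
  ... | yes _  | yes _  = refl
  ... | yes m  | no ¬m  = ⊥-elim (¬m (match-neg m))
  ... | no ¬m  | yes m  = ⊥-elim (¬m (subst (Match r) (neg-involutive s) (match-neg m)))
  ... | no _   | no _   = cong suc (rank-neg R s)

  rank-< : ∀ {R s} → Any (λ r → Match r s) R → rank R s < length R
  rank-< {r ∷ R} {s} any with match? r s | any
  ... | yes _ | _         = s≤s z≤n
  ... | no ¬m | here m    = ⊥-elim (¬m m)
  ... | no _  | there any = s≤s (rank-< any)

  ∣-⇒≡ : ∀ {a b} → a < p → b < p → + p ∣ + a - + b → a ≡ b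
  ∣-⇒≡ {a} {b} a<p b<p p∣ with ℕ.≤-total b a
  ... | inj₁ b≤a = ∣m-n∣⇒≡ a<p b≤a p∣
  ... | inj₂ a≤b = sym (∣m-n∣⇒≡ b<p a≤b (subst (+ p ∣_) (lem (+ a) (+ b)) (∣m⇒∣-m p∣)))
    where
    lem : ∀ a b → - (a - b) ≡ b - a
    lem = solve-∀

  -- The difference of squares factors, and a prime divides one of the factors: squares agree only
  -- up to sign.
  ∣square-difference : Prime p → ∀ {s s′} → toℕ s′ ≢ 0 →
    + p ∣ + toℕ s * + toℕ s - + toℕ s′ * + toℕ s′ → Match s′ s
  ∣square-difference pr {s} {s′} s′≢0 p∣
    with prime⇒prime∣ pr {+ toℕ s - + toℕ s′} {+ toℕ s + + toℕ s′} (subst (+ p ∣_) (lem (+ toℕ s) (+ toℕ s′)) p∣)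
    where
    lem : ∀ a b → a * a - b * b ≡ (a - b) * (a + b)
    lem = solve-∀
  ... | inj₁ p∣- = inj₁ (toℕ-injective (∣-⇒≡ (toℕ<n s) (toℕ<n s′) p∣-))
  ... | inj₂ p∣+ = inj₂ (toℕ-injective (∣-⇒≡ (toℕ<n s) (toℕ<n (neg s′))
      (subst (+ p ∣_) (trans (lem (+ toℕ s) (+ toℕ s′) (+ p)) (cong (λ a → + toℕ s - a) (sym neg-int)))
                      (∣m∣n⇒∣m-n p∣+ ∣-refl))))
    where
    neg-int : + toℕ (neg s′) ≡ + p - + toℕ s′
    neg-int = trans (cong +_ (toℕ-neg s′≢0)) (sym (trans (m-n≡m⊖n p (toℕ s′)) (⊖-≥ (ℕ.<⇒≤ (toℕ<n s′)))))
    lem : ∀ a b q → a + b - q ≡ a - (q - b)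
    lem = solve-∀

  IsRep : Fin p → Set
  IsRep r = 1 ≤ toℕ r × toℕ r ≤ p / 2

  exists-rep : ∀ {s} → toℕ s ≢ 0 → ∃ λ r → IsRep r × Match r s
  exists-rep {s} s≢0 with toℕ s ≤? p / 2
  ... | yes s≤ = s , (ℕ.n≢0⇒n>0 s≢0 , s≤) , inj₁ refl
  ... | no s≰  = neg s , (1≤ , ≤½) , inj₂ (sym (neg-involutive s))
    where
    1≤ : 1 ≤ toℕ (neg s)
    1≤ = subst (1 ≤_) (sym (toℕ-neg s≢0)) (ℕ.m<n⇒0<n∸m (toℕ<n s))
    ≤½ : toℕ (neg s) ≤ p / 2
    ≤½ = begin
      toℕ (neg s)                                   ≡⟨ toℕ-neg s≢0 ⟩
      p ∸ toℕ s                                     ≤⟨ ℕ.∸-monoʳ-≤ p (ℕ.≰⇒> s≰) ⟩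
      p ∸ suc (p / 2)                               ≡⟨ cong (_∸ suc (p / 2)) (m≡m%n+[m/n]*n p 2) ⟩
      -- The remainder modulo 2 is at most 1.
      (p % 2 ℕ.+ p / 2 ℕ.* 2) ∸ suc (p / 2)         ≤⟨ ℕ.∸-monoˡ-≤ (suc (p / 2)) (ℕ.+-monoˡ-≤ (p / 2 ℕ.* 2) (ℕ.≤-pred (m%n<n p 2))) ⟩
      (1 ℕ.+ p / 2 ℕ.* 2) ∸ suc (p / 2)             ≡⟨ cong (_∸ p / 2) (trans (ℕ.*-comm (p / 2) 2) (cong (p / 2 ℕ.+_) (ℕ.+-identityʳ (p / 2)))) ⟩
      (p / 2 ℕ.+ p / 2) ∸ p / 2                     ≡⟨ ℕ.m+n∸n≡m (p / 2) (p / 2) ⟩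
      p / 2                                         ∎
      where open ℕ.≤-Reasoning

  mult-≡ : ∀ {x s} S → s ≡ x → mult p x (s ∷ S) ≡ suc (mult p x S)
  mult-≡ {x} S e = cong length (filter-accept (_≟ x) {xs = S} e)

  mult-≢ : ∀ {x s} S → s ≢ x → mult p x (s ∷ S) ≡ mult p x S
  mult-≢ {x} S ne = cong length (filter-reject (_≟ x) {xs = S} ne)

  commonMult-nomatch : ∀ {r s} S → ¬ Match r s → commonMult p (s ∷ S) r ≡ commonMult p S r
  commonMult-nomatch S ¬m = cong₂ ℕ._+_ (mult-≢ S (¬m ∘ inj₁)) (mult-≢ S (¬m ∘ inj₂))

  commonMult-positive : ∀ {r s S} → s ∈ S → Match r s → 0 < commonMult p S r
  commonMult-positive {r} {s} {S} s∈ (inj₁ refl) =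
    ℕ.<-≤-trans (filter-some (_≟ r) (lose s∈ refl)) (ℕ.m≤m+n _ _)
  commonMult-positive {r} {s} {S} s∈ (inj₂ refl) =
    ℕ.<-≤-trans (filter-some (_≟ neg r) (lose s∈ refl)) (ℕ.m≤n+m _ (mult p r S))

  commonMults-decreasing : ∀ S → AllPairs _≥_ (commonMults p S)
  commonMults-decreasing S = reverse-decreasing (Sorted⇒AllPairs ℕ.≤-totalOrder
    (sort-↗ (filter (0 <?_) (map (commonMult p S) (reps p)))))

  -- Sorting is applied to the multiplicities alone; pulling the permutation back through `map`
  -- orders the representatives accordingly.
  sorted-reps : ∀ S → ∃ λ R → map (commonMult p S) R ≡ commonMults p S ×
                              filter ((0 <?_) ∘ commonMult p S) (reps p) ↭ R
  sorted-reps S =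
    let (R , e , perm) = ↭-map-inv (commonMult p S) (subst (_↭ commonMults p S) (filter-map (0 <?_) (commonMult p S) (reps p))
                           (↭-sym (↭-trans (↭-reverse _) (sort-↭ _))))
    in R , sym e , perm

  module _ (pr : Prime p) (p≢2 : p ≢ 2) where

    -- Otherwise p would be the sum of two representatives, hence at most twice the rounded-down
    -- half of p. This makes p even, against p being a prime other than 2.
    rep≢neg : ∀ {r r′} → IsRep r → IsRep r′ → r ≢ neg r′
    rep≢neg {r} {r′} (_ , r≤) (1≤r′ , r′≤) refl with prime⇒irreducible pr {2} (ℕ∣.divides (p / 2) p≡)
      where
      p≤ : p ≤ p / 2 ℕ.* 2
      p≤ = begin
        p                         ≡⟨ sym (ℕ.m∸n+n≡m (ℕ.<⇒≤ (toℕ<n r′))) ⟩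
        p ∸ toℕ r′ ℕ.+ toℕ r′     ≡⟨ cong (ℕ._+ toℕ r′) (sym (toℕ-neg (ℕ.m<n⇒n≢0 1≤r′))) ⟩
        toℕ r ℕ.+ toℕ r′          ≤⟨ ℕ.+-mono-≤ r≤ r′≤ ⟩
        p / 2 ℕ.+ p / 2           ≡⟨ cong (p / 2 ℕ.+_) (sym (ℕ.+-identityʳ (p / 2))) ⟩
        2 ℕ.* (p / 2)             ≡⟨ ℕ.*-comm 2 (p / 2) ⟩
        p / 2 ℕ.* 2               ∎
        where open ℕ.≤-Reasoning
      p≡ : p ≡ p / 2 ℕ.* 2
      p≡ = ℕ.≤-antisym p≤ (ℕ.≤-trans (ℕ.m≤n+m _ (p % 2)) (ℕ.≤-reflexive (sym (m≡m%n+[m/n]*n p 2))))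
    ... | inj₁ ()
    ... | inj₂ 2≡p = p≢2 (sym 2≡p)

    match-unique : ∀ {r r′ s} → IsRep r → IsRep r′ → Match r s → Match r′ s → r ≡ r′
    match-unique rep rep′ (inj₁ refl) (inj₁ refl) = refl
    match-unique rep rep′ (inj₁ refl) (inj₂ e)    = ⊥-elim (rep≢neg rep rep′ e)
    match-unique rep rep′ (inj₂ refl) (inj₁ e)    = ⊥-elim (rep≢neg rep′ rep (sym e))
    match-unique rep rep′ (inj₂ refl) (inj₂ e)    =
      trans (sym (neg-involutive _)) (trans (cong neg e) (neg-involutive _))

    commonMult-match : ∀ {r s} S → IsRep r → Match r s → commonMult p (s ∷ S) r ≡ suc (commonMult p S r)
    commonMult-match S rep (inj₁ refl) = cong₂ ℕ._+_ (mult-≡ S refl) (mult-≢ S (rep≢neg rep rep))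
    commonMult-match {r} S rep (inj₂ refl) =
      trans (cong₂ ℕ._+_ (mult-≢ S (λ e → rep≢neg rep rep (sym e))) (mult-≡ S refl)) (ℕ.+-suc (mult p r S) _)

    -- By `match-unique`, a term matches exactly one representative, and `rank` gives its position.
    commonMult-bump : ∀ {R} S {s} → All IsRep R → Unique R → Any (λ r → Match r s) R →
      map (commonMult p (s ∷ S)) R ≡ bump (rank R s) (map (commonMult p S) R)
    commonMult-bump {r ∷ R} S {s} (rep ∷ reps) (r∉ ∷ R!) any with match? r s | any
    ... | yes m | _ = cong₂ _∷_ (commonMult-match S rep m)
      (map-cong-local (All.zipWith (λ { (rep′ , r≢) → commonMult-nomatch S (λ m′ → r≢ (match-unique rep rep′ m m′)) }) (reps , r∉)))
    ... | no ¬m | here m    = ⊥-elim (¬m m)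
    ... | no ¬m | there any = cong₂ _∷_ (commonMult-nomatch S ¬m) (commonMult-bump S reps R! any)

    module _ {R : List (Fin p)} (R-reps : All IsRep R) (R! : Unique R) where

      open Labelling (rank R)

      -- Induction on the sequence with `R` fixed. Multiplicities of a tail may fail to decrease
      -- along `R`, so the order enters only in `count-decreasing`, for the whole sequence.
      count-nth : ∀ {S} → All (λ s → Any (λ r → Match r s) R) S → ∀ i →
        count i S ≡ nth (map (commonMult p S) R) i
      count-nth [] i = sym (zeros R i)
        where
        zeros : ∀ R i → nth (map (commonMult p []) R) i ≡ 0
        zeros []      i       = refl
        zeros (r ∷ R) zero    = refl
        zeros (r ∷ R) (suc i) = zeros R i
      count-nth {s ∷ S} (c ∷ cs) i with rank R s ℕ.≟ i
      ... | yes refl = trans (cong suc (count-nth cs i)) (sym (trans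
              (cong (λ ls → nth ls i) (commonMult-bump S R-reps R! c))
              (nth-bump-self (map (commonMult p S) R) (subst (rank R s <_) (sym (length-map _ R)) (rank-< c)))))
      ... | no ≢i = trans (count-nth cs i) (sym (trans
              (cong (λ ls → nth ls i) (commonMult-bump S R-reps R! c))
              (nth-bump-other (map (commonMult p S) R) ≢i)))

      height-labels : ∀ {S} → All (λ s → Any (λ r → Match r s) R) S →
        height (labels S) full ≡ weightedSum (map (commonMult p S) R)
      height-labels [] = sym (zeros 1 R)
        where
        zeros : ∀ k R → weightedSumFrom k (map (commonMult p []) R) ≡ 0
        zeros k []      = refl
        zeros k (r ∷ R) = cong₂ ℕ._+_ (ℕ.*-zeroʳ k) (zeros (suc k) R)
      height-labels {s ∷ S} (c ∷ cs) = trans (cong (suc (rank R s) ℕ.+_) (height-labels cs)) (sym (trans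
        (cong weightedSum (commonMult-bump S R-reps R! c))
        (weightedSumFrom-bump 1 (map (commonMult p S) R) (subst (rank R s <_) (sym (length-map _ R)) (rank-< c)))))

    -- Assembly for a sequence of nonzero residues.

    module _ (S : List (Fin p)) (S≢0 : All (λ s → s ≢ zeroₚ p) S) where

      nonzero-∈ : ∀ {s} → s ∈ S → toℕ s ≢ 0
      nonzero-∈ s∈ e = All.lookup S≢0 s∈ (toℕ-injective (trans e (sym (toℕ-zeroₚ p))))

      private
        R    = proj₁ (sorted-reps S)
        R-≡  = proj₁ (proj₂ (sorted-reps S))
        perm = proj₂ (proj₂ (sorted-reps S))

      open Labelling (rank R)

      R-reps : All IsRep R
      R-reps = All.tabulate λ r∈ → proj₂ (∈-filter⁻ _ {xs = allFin p}
        (proj₁ (∈-filter⁻ _ {xs = reps p} (∈-resp-↭ (↭-sym perm) r∈))))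

      R-unique : Unique R
      R-unique = Permₛ.Unique-resp-↭ (setoid (Fin p)) (↭⇒↭ₛ perm)
        (Unique.filter⁺ _ (Unique.filter⁺ _ (Unique.allFin⁺ p)))

      R-covers : All (λ s → Any (λ r → Match r s) R) S
      R-covers = All.tabulate λ s∈ →
        let (r , rep , m) = exists-rep (nonzero-∈ s∈)
        in lose (∈-resp-↭ perm (∈-filter⁺ _ (∈-filter⁺ _ (∈-allFin r) rep) (commonMult-positive s∈ m))) m

      count-decreasing : ∀ i → count (suc i) S ≤ count i S
      count-decreasing i = subst₂ _≤_ (nth-count (suc i)) (nth-count i) (nth-decreasing (commonMults-decreasing S) i)
        where
        nth-count : ∀ i → nth (commonMults p S) i ≡ count i S
        nth-count i = sym (trans (count-nth R-reps R-unique R-covers i) (cong (λ ls → nth ls i) R-≡))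

      value-at : Site → Fin p
      value-at = val (zeroₚ p) S

      -- Equal squares modulo p force equal or opposite residues, hence the same rank, that is, the
      -- same column. Two sites of one row would then coincide.
      labels-nondegenerate : ∀ zs → Nondegenerate (+ p) (labels S) (residueState p value-at (labels S) zs)
      labels-nondegenerate zs = record
        { nonzero  = λ {t} t∈ p∣ → nonzero-∈ (val-∈ _ t∈)
            (∣-⇒≡ (toℕ<n (value-at t)) (ℕ.>-nonZero⁻¹ p) (subst (+ p ∣_) (lem₁ (+ toℕ (value-at t))) (∣m⇒∣-m p∣)))
        ; distinct = λ {t} {t′} t∈ t′∈ row t≢ p∣ → t≢ (cong₂ _,_
            (trans (sym (cls-val _ t∈)) (trans
              (same-rank (∣square-difference pr (nonzero-∈ (val-∈ _ t′∈))
                (subst (+ p ∣_) (lem₂ (+ toℕ (value-at t)) (+ toℕ (value-at t′))) p∣)))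
              (cls-val _ t′∈)))
            row)
        }
        where
        lem₁ : ∀ a → - - a ≡ a - 0ℤ
        lem₁ = solve-∀
        lem₂ : ∀ a b → - a * - a - - b * - b ≡ a * a - b * b
        lem₂ = solve-∀
        same-rank : ∀ {s s′} → Match s′ s → rank R s ≡ rank R s′
        same-rank (inj₁ refl)      = refl
        same-rank {s′ = s′} (inj₂ refl) = rank-neg R s′

      subsetSums-bounds : (|Σ| p S ≥ p ⊓ (1 ℕ.+ weightedSum (commonMults p S)))
                        × (|Σ*| p S ≥ p ⊓ weightedSum (commonMults p S))
      subsetSums-bounds = subst₂ (λ T N → (|Σ| p T ≥ p ⊓ (1 ℕ.+ N)) × (|Σ*| p T ≥ p ⊓ N))
        (map-val (zeroₚ p) S)
        (trans (height-labels R-reps R-unique R-covers) (cong weightedSum R-≡))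
        ( |Σ|-bound p value-at (labels-unique S) (labels-closed count-decreasing) pr labels-nondegenerate
        , |Σ*|-bound p value-at (labels-unique S) (labels-closed count-decreasing) pr labels-nondegenerate)

theorem6 : (p : ℕ) .{{_ : NonZero p}} → Prime p → p ≢ 2 →
    (S : List (Fin p)) → All (λ s → s ≢ zeroₚ p) S →
    (|Σ| p S ≥ p ⊓ (1 ℕ.+ weightedSum (commonMults p S)))
    × (|Σ*| p S ≥ p ⊓ weightedSum (commonMults p S))
theorem6 p pr p≢2 S S≢0 = subsetSums-bounds p pr p≢2 S S≢0
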